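{- Let $G,H$ be graphs with $|V(G)|=n\ge 1$. If $\gamma_{st}(H)\ge 2$, then $\operatorname{st}_{\gamma_{st}}(G\circ H)=1$.
   Context: All graphs are finite, simple and undirected. For a graph $G=(V,E)$, a set $D\subseteq V$ is a strong dominating set if every vertex $v\in V\setminus D$ is adjacent to some $u\in D$ with $\deg(v)\le\deg(u)$ (degrees taken in $G$). The strong domination number $\gamma_{st}(G)$ is the minimum size of a strong dominating set. For $S\subseteq V$, $G-S$ is the graph obtained by deleting the vertices of $S$. The stability of the strong domination number is $\operatorname{st}_{\gamma_{st}}(G)=\min\{|S| : S\subseteq V,\ \gamma_{st}(G-S)\ne\gamma_{st}(G)\}$. The corona $G\circ H$ is obtained by taking one copy of $G$ and $|V(G)|$ copies of $H$, and joining each vertex of the $i$-th copy of $H$ to the $i$-th vertex of $G$. -}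

module Defs where

open import Data.Bool.Base using (true; false)
open import Data.Empty using (⊥-elim)
open import Data.Fin.Base using (Fin; zero; suc; splitAt; remQuot)
open import Data.Fin.Properties as Fin using (all?; any?)
open import Data.Fin.Subset using (Subset; _∈_; _∉_; ∣_∣; ∁; ⊤)
open import Data.Fin.Subset.Properties using (_∈?_; anySubset?; ∈⊤)
open import Data.Nat.Base using (ℕ; zero; suc; _+_; _*_; _≤_; z≤n; s≤s)
open import Data.Nat.Properties using (_≤?_; _≟_)
open import Data.Product.Base using (∃; _×_; _,_; proj₁)
open import Data.Sum.Base as Sum using (_⊎_; inj₁; inj₂)
open import Data.Vec.Base using (_∷_; tabulate)
open import Function.Base using (_∘_; _on_)
open import Relation.Binary.Core using (Rel)
open import Relation.Binary.Definitions using (Symmetric)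
import Relation.Binary.Definitions as Binary
open import Relation.Binary.PropositionalEquality using (_≡_; _≢_; refl; sym)
open import Relation.Nullary.Decidable using (yes; no; does; ¬?; _×-dec_; _→-dec_)
open import Relation.Nullary.Negation using (¬_)
open import Relation.Unary using (Pred; Decidable)
open import Level using (0ℓ)

IsMinimum : Pred ℕ 0ℓ → ℕ → Set
IsMinimum P k = P k × (∀ j → P j → k ≤ j)

minimum : {P : Pred ℕ 0ℓ} → Decidable P → ∀ n → P n → ∃ (IsMinimum P)
minimum P? n p with P? zero
... | yes p₀ = zero , p₀ , λ _ _ → z≤n
minimum P? zero    p | no ¬p₀ = ⊥-elim (¬p₀ p)
minimum {P} P? (suc n) p | no ¬p₀ with minimum (P? ∘ suc) n p
... | k , pₖ , least = suc k , pₖ , below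
  where
  below : ∀ j → P j → suc k ≤ j
  below zero    q = ⊥-elim (¬p₀ q)
  below (suc j) q = s≤s (least j q)

record SimpleGraph (V : Set) : Set₁ where
  infix 4 _~_ _~?_
  field
    _~_      : Rel V 0ℓ
    _~?_     : Binary.Decidable _~_
    ~-sym    : Symmetric _~_
    ~-irrefl : ∀ {v} → ¬ (v ~ v)

pullback : {V W : Set} → (W → V) → SimpleGraph V → SimpleGraph W
pullback f G = record
  { _~_      = _~_ on f
  ; _~?_     = λ v w → f v ~? f w
  ; ~-sym    = ~-sym
  ; ~-irrefl = ~-irrefl
  } where open SimpleGraph G

Graph : ℕ → Set₁
Graph n = SimpleGraph (Fin n)

module _ {n : ℕ} (G : Graph n) where
  open SimpleGraph G

  neighbours : Fin n → Subset n
  neighbours v = tabulate λ u → does (v ~? u)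

  deg : Fin n → ℕ
  deg v = ∣ neighbours v ∣

  StrongDominating : Subset n → Set
  StrongDominating D = ∀ v → v ∉ D → ∃ λ u → u ∈ D × v ~ u × deg v ≤ deg u

  strongDominating? : Decidable StrongDominating
  strongDominating? D = all? λ v → ¬? (v ∈? D) →-dec
    any? λ u → (u ∈? D) ×-dec (v ~? u) ×-dec (deg v ≤? deg u)

  HasStrongDominatingSet : ℕ → Set
  HasStrongDominatingSet k = ∃ λ D → StrongDominating D × ∣ D ∣ ≡ k

  γst-spec : ∃ (IsMinimum HasStrongDominatingSet)
  γst-spec = minimum
    (λ k → anySubset? λ D → strongDominating? D ×-dec (∣ D ∣ ≟ k))
    ∣ ⊤ {n} ∣
    (⊤ , (λ v v∉⊤ → ⊥-elim (v∉⊤ ∈⊤)) , refl)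

  γst : ℕ
  γst = proj₁ γst-spec

-- The increasing enumeration of the elements of a subset.
embed : ∀ {n} (p : Subset n) → Fin ∣ p ∣ → Fin n
embed (true  ∷ p) zero    = zero
embed (true  ∷ p) (suc i) = suc (embed p i)
embed (false ∷ p) i       = suc (embed p i)

infixl 6 _-_
_-_ : ∀ {n} → Graph n → (S : Subset n) → Graph ∣ ∁ S ∣
G - S = pullback (embed (∁ S)) G

-- The stability is a relation rather than a function because for the graph
-- without vertices no S changes γst, so the minimum does not exist.
IsStability : ∀ {n} → Graph n → ℕ → Set
IsStability G = IsMinimum λ k → ∃ λ S → ∣ S ∣ ≡ k × γst (G - S) ≢ γst G

module _ {n m : ℕ} (G : Graph n) (H : Graph m) where
  private
    module G = SimpleGraph G
    module H = SimpleGraph H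

  -- inj₁ i is the i-th vertex of G, and inj₂ (i , a) is the vertex a in the
  -- i-th copy of H.
  CoronaVertex : Set
  CoronaVertex = Fin n ⊎ (Fin n × Fin m)

  CoronaAdj : Rel CoronaVertex 0ℓ
  CoronaAdj (inj₁ i)       (inj₁ j)       = i G.~ j
  CoronaAdj (inj₁ i)       (inj₂ (j , _)) = i ≡ j
  CoronaAdj (inj₂ (i , _)) (inj₁ j)       = i ≡ j
  CoronaAdj (inj₂ (i , a)) (inj₂ (j , b)) = i ≡ j × a H.~ b

  coronaGraph : SimpleGraph CoronaVertex
  coronaGraph = record
    { _~_      = CoronaAdj
    ; _~?_     = dec
    ; ~-sym    = λ {x} {y} → symm x y
    ; ~-irrefl = λ {x} → irr x
    }
    where
    dec : Binary.Decidable CoronaAdj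
    dec (inj₁ i)       (inj₁ j)       = i G.~? j
    dec (inj₁ i)       (inj₂ (j , _)) = i Fin.≟ j
    dec (inj₂ (i , _)) (inj₁ j)       = i Fin.≟ j
    dec (inj₂ (i , a)) (inj₂ (j , b)) = (i Fin.≟ j) ×-dec (a H.~? b)

    symm : ∀ x y → CoronaAdj x y → CoronaAdj y x
    symm (inj₁ _) (inj₁ _) e       = G.~-sym e
    symm (inj₁ _) (inj₂ _) e       = sym e
    symm (inj₂ _) (inj₁ _) e       = sym e
    symm (inj₂ _) (inj₂ _) (e , f) = sym e , H.~-sym f

    irr : ∀ x → ¬ CoronaAdj x x
    irr (inj₁ _) e       = G.~-irrefl e
    irr (inj₂ _) (_ , f) = H.~-irrefl f

infixl 7 _⊚_
-- The corona, its vertices numbered by the bijections splitAt and remQuot.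
_⊚_ : ∀ {n m} → Graph n → Graph m → Graph (n + n * m)
_⊚_ {n} {m} G H = pullback (Sum.map₂ (remQuot m) ∘ splitAt n) (coronaGraph G H)

-- The vertices of G strongly dominate the corona, so γst (G ⊚ H) ≤ n.  Delete a
-- vertex i of G.  A strong dominating set D of what remains still meets the block
-- of each vertex j (j together with its copy of H).  The i-th copy of H has become
-- a union of components, so D restricts to a strong dominating set of it, which has
-- at least two elements.  Hence ∣ D ∣ > n.
{-# OPTIONS --safe #-}
module Submission where

open import Defs
open import Data.Fin.Base
  using (Fin; zero; suc; splitAt; remQuot; combine; _↑ˡ_; _↑ʳ_; fromℕ<)
open import Data.Fin.Properties as Fin
  using (suc-injective; injective⇒≤; splitAt-↑ˡ; splitAt-↑ʳ; join-splitAt;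
         remQuot-combine; combine-remQuot)
open import Data.Fin.Subset using (Subset; _∈_; _∉_; ∣_∣; ∁; ⊤; ⁅_⁆)
open import Data.Fin.Subset.Properties
  using (_∈?_; ∈⊤; ∣⊤∣≡n; ∣⁅x⁆∣≡1; x∈⁅x⁆; x∈⁅y⁆⇒x≡y; x∉p⇒x∈∁p; x∈∁p⇒x∉p; p⊆q⇒∣p∣≤∣q∣)
open import Data.Bool.Base using (true; false)
open import Data.Nat.Base using (ℕ; zero; suc; _+_; _*_; _≤_; _<_; z≤n; s≤s)
open import Data.Nat.Properties
  using (≤-trans; ≤-reflexive; ≤-antisym; <⇒≱; module ≤-Reasoning)
open import Data.Product.Base using (∃; _×_; _,_; proj₁; proj₂)
open import Data.Product.Properties using (,-injectiveʳ)
open import Data.Sum.Base as Sum using (_⊎_; inj₁; inj₂)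
open import Data.Sum.Properties using (inj₂-injective)
open import Data.Vec.Base using (_∷_; tabulate; here; there)
open import Data.Vec.Properties using (lookup∘tabulate; lookup⇒[]=; []=⇒lookup)
open import Function.Base using (_∘_; id)
open import Function.Definitions using (Injective)
open import Relation.Binary.PropositionalEquality
  using (_≡_; _≢_; refl; sym; trans; cong; subst; subst₂)
open import Relation.Nullary.Decidable using (yes; no; does; dec-true; _×-dec_)
open import Relation.Nullary.Negation using (contradiction)
open import Relation.Unary using (Pred; Decidable)
open import Level using (0ℓ)

-- Finite subsets

module _ {n : ℕ} {P : Pred (Fin n) 0ℓ} (P? : Decidable P) where

  ∈-tabulate⁺ : ∀ {x} → P x → x ∈ tabulate (does ∘ P?)
  ∈-tabulate⁺ {x} px =
    lookup⇒[]= x _ (trans (lookup∘tabulate (does ∘ P?) x) (dec-true (P? x) px))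

  ∈-tabulate⁻ : ∀ {x} → x ∈ tabulate (does ∘ P?) → P x
  ∈-tabulate⁻ {x} x∈
    with P? x | trans (sym (lookup∘tabulate (does ∘ P?) x)) ([]=⇒lookup x∈)
  ... | yes px | _ = px
  ... | no _   | ()

embed-∈ : ∀ {n} (p : Subset n) i → embed p i ∈ p
embed-∈ (true  ∷ p) zero    = here
embed-∈ (true  ∷ p) (suc i) = there (embed-∈ p i)
embed-∈ (false ∷ p) i       = there (embed-∈ p i)

embed-injective : ∀ {n} (p : Subset n) → Injective _≡_ _≡_ (embed p)
embed-injective (true  ∷ p) {zero}  {zero}  _  = refl
embed-injective (true  ∷ p) {suc i} {suc j} eq =
  cong suc (embed-injective p (suc-injective eq))
embed-injective (false ∷ p) eq = embed-injective p (suc-injective eq)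

embed-surjective : ∀ {n} (p : Subset n) {x} → x ∈ p → ∃ λ i → embed p i ≡ x
embed-surjective (true  ∷ p) here = zero , refl
embed-surjective (true  ∷ p) (there x∈p) with embed-surjective p x∈p
... | i , refl = suc i , refl
embed-surjective (false ∷ p) (there x∈p) with embed-surjective p x∈p
... | i , refl = i , refl

module _ {a b : ℕ} (R : Fin a → Fin b → Set)
         (left-unique : ∀ {x x′ y} → R x y → R x′ y → x ≡ x′) where

  -- Choosing for each element of `p` a related element of `q` is injective, because `R` is
  -- left-unique. The relational form allows maps that are defined only on `p`, as in the
  -- comparisons of neighbourhoods below.
  ∣∣-mono : (p : Subset a) (q : Subset b) →
            (∀ {x} → x ∈ p → ∃ λ y → y ∈ q × R x y) → ∣ p ∣ ≤ ∣ q ∣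
  ∣∣-mono p q total = injective⇒≤ {f = f} f-injective
    where
    g : ∀ i → ∃ λ y → y ∈ q × R (embed p i) y
    g i = total (embed-∈ p i)

    f : Fin ∣ p ∣ → Fin ∣ q ∣
    f i = proj₁ (embed-surjective q (proj₁ (proj₂ (g i))))

    embed-f : ∀ i → embed q (f i) ≡ proj₁ (g i)
    embed-f i = proj₂ (embed-surjective q (proj₁ (proj₂ (g i))))

    f-related : ∀ i → R (embed p i) (embed q (f i))
    f-related i = subst (R _) (sym (embed-f i)) (proj₂ (proj₂ (g i)))

    f-injective : Injective _≡_ _≡_ f
    f-injective {i} {j} eq = embed-injective p
      (left-unique (f-related i) (subst (R _ ∘ embed q) (sym eq) (f-related j)))

∣p∣≡0⇒x∉p : ∀ {n} {p : Subset n} {x} → ∣ p ∣ ≡ 0 → x ∉ p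
∣p∣≡0⇒x∉p {p = p} {x} ∣p∣≡0 x∈p
  with subst₂ _≤_ (∣⁅x⁆∣≡1 x) ∣p∣≡0 (p⊆q⇒∣p∣≤∣q∣ {p = ⁅ x ⁆} {q = p}
         λ y∈⁅x⁆ → subst (_∈ p) (sym (x∈⁅y⁆⇒x≡y x y∈⁅x⁆)) x∈p)
... | ()

∃-other : ∀ {n} (p : Subset n) → 2 ≤ ∣ p ∣ → ∀ x → ∃ λ y → y ∈ p × y ≢ x
∃-other p 2≤∣p∣ x = pick (embed-∈ p) (embed-injective p) 2≤∣p∣
  where
  -- With the cardinality generalised to `k`, matching on `2 ≤ k` exposes two indices; by
  -- injectivity at most one of them is sent to `x`.
  pick : ∀ {k} {f : Fin k → Fin _} → (∀ i → f i ∈ p) → Injective _≡_ _≡_ f →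
         2 ≤ k → ∃ λ y → y ∈ p × y ≢ x
  pick {f = f} f∈p f-injective (s≤s (s≤s _)) with f zero Fin.≟ x
  ... | no  f₀≢x = f zero , f∈p zero , f₀≢x
  ... | yes f₀≡x = f (suc zero) , f∈p (suc zero) , λ f₁≡x →
    contradiction (f-injective (trans f₀≡x (sym f₁≡x))) λ ()

-- Strong domination

module _ {n : ℕ} (G : Graph n) where
  open SimpleGraph G

  γst-attained : HasStrongDominatingSet G (γst G)
  γst-attained = proj₁ (proj₂ (γst-spec G))

  γst-least : ∀ D → StrongDominating G D → γst G ≤ ∣ D ∣
  γst-least D sd = proj₂ (proj₂ (γst-spec G)) ∣ D ∣ (D , sd , refl)

module _ {a b : ℕ} (K : Graph a) (L : Graph b) where
  private
    module K = SimpleGraph K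
    module L = SimpleGraph L

  -- Every comparison of degrees below, for isomorphisms and for coronas, is an instance of this
  -- one.
  deg-mono : (R : Fin a → Fin b → Set) → (∀ {x x′ y} → R x y → R x′ y → x ≡ x′) →
             ∀ {v w} → (∀ {x} → v K.~ x → ∃ λ y → w L.~ y × R x y) →
             deg K v ≤ deg L w
  deg-mono R left-unique {v} {w} total =
    ∣∣-mono R left-unique (neighbours K v) (neighbours L w) λ x∈N →
      let y , w~y , xRy = total (∈-tabulate⁻ (v K.~?_) x∈N)
      in  y , ∈-tabulate⁺ (w L.~?_) w~y , xRy

-- Isomorphisms of graphs

record _≅_ {a b} (K : Graph a) (L : Graph b) : Set where
  private
    module K = SimpleGraph K
    module L = SimpleGraph L
  field
    to      : Fin a → Fin b
    from    : Fin b → Fin a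
    to∘from : ∀ w → to (from w) ≡ w
    from∘to : ∀ v → from (to v) ≡ v
    to-~    : ∀ {v w} → v K.~ w → to v L.~ to w
    from-~  : ∀ {v w} → v L.~ w → from v K.~ from w

≅-sym : ∀ {a b} {K : Graph a} {L : Graph b} → K ≅ L → L ≅ K
≅-sym K≅L = record
  { to = from ; from = to ; to∘from = from∘to ; from∘to = to∘from
  ; to-~ = from-~ ; from-~ = to-~ }
  where open _≅_ K≅L

module _ {a b} {K : Graph a} {L : Graph b} (K≅L : K ≅ L) where
  open _≅_ K≅L
  private
    module K = SimpleGraph K
    module L = SimpleGraph L

  ≅⇒deg-≤ : ∀ v → deg K v ≤ deg L (to v)
  ≅⇒deg-≤ v = deg-mono K L (λ x y → x ≡ from y)
    (λ x≡ x′≡ → trans x≡ (sym x′≡))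
    (λ {x} v~x → to x , to-~ v~x , sym (from∘to x))

-- Pulling a minimum strong dominating set of `K` back along `from` gives one of `L` that is no
-- larger; degrees are compared once in each direction of the isomorphism.
≅⇒γst-≤ : ∀ {a b} {K : Graph a} {L : Graph b} → K ≅ L → γst L ≤ γst K
≅⇒γst-≤ {K = K} {L} K≅L with γst-attained K
... | D , sd , ∣D∣≡γst = begin
    γst L  ≤⟨ γst-least L D′ sd′ ⟩
    ∣ D′ ∣ ≤⟨ ∣∣-mono (λ x y → x ≡ to y) (λ x≡ x′≡ → trans x≡ (sym x′≡)) D′ D
                (λ {w} w∈D′ → from w , ∈-tabulate⁻ D′? w∈D′ , sym (to∘from w)) ⟩
    ∣ D ∣  ≡⟨ ∣D∣≡γst ⟩
    γst K  ∎
  where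
  open ≤-Reasoning
  open _≅_ K≅L
  module L = SimpleGraph L

  D′? : Decidable (λ w → from w ∈ D)
  D′? w = from w ∈? D

  D′ : Subset _
  D′ = tabulate (does ∘ D′?)

  sd′ : StrongDominating L D′
  sd′ w w∉D′ with sd (from w) (w∉D′ ∘ ∈-tabulate⁺ D′?)
  ... | u , u∈D , w~u , deg-≤ =
    to u ,
    ∈-tabulate⁺ D′? (subst (_∈ D) (sym (from∘to u)) u∈D) ,
    subst (L._~ to u) (to∘from w) (to-~ w~u) ,
    ≤-trans (≅⇒deg-≤ (≅-sym K≅L) w) (≤-trans deg-≤ (≅⇒deg-≤ K≅L u))

≅⇒γst-≡ : ∀ {a b} {K : Graph a} {L : Graph b} → K ≅ L → γst K ≡ γst L
≅⇒γst-≡ K≅L = ≤-antisym (≅⇒γst-≤ (≅-sym K≅L)) (≅⇒γst-≤ K≅L)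

-- The vertex type of `G - S` is `Fin ∣ ∁ S ∣`, so even when nothing is deleted the result is
-- compared with `G` by an isomorphism. This excludes stability 0.
∣S∣≡0⇒G-S≅G : ∀ {n} (G : Graph n) (S : Subset n) → ∣ S ∣ ≡ 0 → (G - S) ≅ G
∣S∣≡0⇒G-S≅G G S ∣S∣≡0 = record
  { to      = embed (∁ S)
  ; from    = from
  ; to∘from = to∘from
  ; from∘to = λ v → embed-injective (∁ S) (to∘from (embed (∁ S) v))
  ; to-~    = id
  ; from-~  = subst₂ _~_ (sym (to∘from _)) (sym (to∘from _))
  }
  where
  open SimpleGraph G

  preimage : ∀ v → ∃ λ i → embed (∁ S) i ≡ v
  preimage v = embed-surjective (∁ S) (x∉p⇒x∈∁p (∣p∣≡0⇒x∉p ∣S∣≡0))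

  from : Fin _ → Fin ∣ ∁ S ∣
  from = proj₁ ∘ preimage

  to∘from : ∀ v → embed (∁ S) (from v) ≡ v
  to∘from = proj₂ ∘ preimage

-- Coronas

module _ {n m : ℕ} where

  -- This is the numbering used by `_⊚_`, so `G ⊚ H` is definitionally `Labelled` for the labelling
  -- `decode`.
  decode : Fin (n + n * m) → Fin n ⊎ (Fin n × Fin m)
  decode = Sum.map₂ (remQuot m) ∘ splitAt n

  encode : Fin n ⊎ (Fin n × Fin m) → Fin (n + n * m)
  encode (inj₁ i)       = i ↑ˡ (n * m)
  encode (inj₂ (i , a)) = n ↑ʳ combine i a

  decode-encode : ∀ x → decode (encode x) ≡ x
  decode-encode (inj₁ i)
    rewrite splitAt-↑ˡ n i (n * m) = refl
  decode-encode (inj₂ (i , a))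
    rewrite splitAt-↑ʳ n (n * m) (combine i a) = cong inj₂ (remQuot-combine i a)

  encode-decode : ∀ v → encode (decode v) ≡ v
  encode-decode v with splitAt n v | join-splitAt n (n * m) v
  ... | inj₁ i | eq = eq
  ... | inj₂ k | eq = trans (cong (n ↑ʳ_) (combine-remQuot {n} m k)) eq

  decode-injective : Injective _≡_ _≡_ decode
  decode-injective {v} {w} eq =
    trans (sym (encode-decode v)) (trans (cong encode eq) (encode-decode w))

  block : Fin n ⊎ (Fin n × Fin m) → Fin n
  block (inj₁ i)       = i
  block (inj₂ (i , _)) = i

module _ {n m : ℕ} (G : Graph n) (H : Graph m) where
  private
    module H = SimpleGraph H
    module C = SimpleGraph (coronaGraph G H)

  -- Edges between different blocks join two roots.
  copy-~⇒block : ∀ {i a} x → inj₂ (i , a) C.~ x → block x ≡ i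
  copy-~⇒block (inj₁ _) i≡j       = sym i≡j
  copy-~⇒block (inj₂ _) (i≡j , _) = sym i≡j

  -- A labelling ℓ exhibits a graph as an induced subgraph of the corona.
  module _ {k : ℕ} (ℓ : Fin k → CoronaVertex G H) (ℓ-injective : Injective _≡_ _≡_ ℓ) where

    Labelled : Graph k
    Labelled = pullback ℓ (coronaGraph G H)

    -- The map inj₁ i ↦ inj₂ (i , a) and inj₂ (i , b) ↦ inj₂ (i , b) from the
    -- neighbours of inj₂ (i , a) to those of inj₁ i is injective, as a ≁ a.
    deg-copy-≤-deg-root : ∀ {v w i a} → ℓ v ≡ inj₂ (i , a) → ℓ w ≡ inj₁ i →
                          deg Labelled v ≤ deg Labelled w
    deg-copy-≤-deg-root {v} {w} {i} {a} ℓv≡ ℓw≡ =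
      deg-mono Labelled Labelled R left-unique total
      where
      R : Fin k → Fin k → Set
      -- The first disjunct sends the root to `v`, the second fixes the other neighbours; `v ≢ y`
      -- keeps the two images apart.
      R x y = (x ≡ w × y ≡ v) ⊎ (x ≡ y × v ≢ y)

      left-unique : ∀ {x x′ y} → R x y → R x′ y → x ≡ x′
      left-unique (inj₁ (refl , _))   (inj₁ (refl , _))   = refl
      left-unique (inj₁ (_ , y≡v))    (inj₂ (_ , v≢y))    = contradiction (sym y≡v) v≢y
      left-unique (inj₂ (_ , v≢y))    (inj₁ (_ , y≡v))    = contradiction (sym y≡v) v≢y
      left-unique (inj₂ (refl , _))   (inj₂ (refl , _))   = refl

      total : ∀ {x} → ℓ v C.~ ℓ x → ∃ λ y → ℓ w C.~ ℓ y × R x y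
      total {x} v~x with ℓ x in ℓx≡
      ... | inj₁ j = v , subst₂ C._~_ (sym ℓw≡) (sym ℓv≡) refl ,
        inj₁ (ℓ-injective (trans ℓx≡ (trans (cong inj₁ j≡i) (sym ℓw≡))) , refl)
        where
        j≡i : j ≡ i
        j≡i = copy-~⇒block {a = a} (inj₁ j) (subst (C._~ inj₁ j) ℓv≡ v~x)
      ... | inj₂ (j , b) = x , subst₂ C._~_ (sym ℓw≡) (sym ℓx≡) (sym j≡i) ,
        inj₂ (refl , v≢x)
        where
        j≡i : j ≡ i
        j≡i = copy-~⇒block (inj₂ (j , b)) (subst (C._~ inj₂ (j , b)) ℓv≡ v~x)

        v≢x : v ≢ x
        v≢x refl = C.~-irrefl {ℓ v} (subst (ℓ v C.~_) (sym ℓx≡) v~x)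

    -- The corona with one root deleted

    module _ {i : Fin n} (root-deleted : ∀ v → ℓ v ≢ inj₁ i)
             (others-kept : ∀ x → x ≢ inj₁ i → ∃ λ v → ℓ v ≡ x) where

      private
        copy : ∀ j a → ∃ λ v → ℓ v ≡ inj₂ (j , a)
        copy j a = others-kept (inj₂ (j , a)) λ ()

        IsCopy : Fin m → Fin k → Set
        IsCopy a v = ℓ v ≡ inj₂ (i , a)

        -- A neighbour lies in block `i`, and the only vertex of that block outside the copy is the
        -- deleted root.
        copy-neighbour : ∀ {v a u} → IsCopy a v → ℓ v C.~ ℓ u →
                         ∃ λ b → IsCopy b u × a H.~ b
        copy-neighbour {v} {a} {u} ℓv≡ v~u with ℓ u in ℓu≡
        ... | inj₁ j = contradiction
          (trans ℓu≡ (cong inj₁ (copy-~⇒block {a = a} (inj₁ j) (subst (C._~ inj₁ j) ℓv≡ v~u))))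
          (root-deleted u)
        ... | inj₂ (j , b) with subst (C._~ inj₂ (j , b)) ℓv≡ v~u
        ...   | refl , a~b = b , refl , a~b

      -- The whole copy survives, so no neighbour from `H` is lost; in `deg-≤-H`, `copy-neighbour`
      -- rules out any further neighbour. Together they let the degree condition pass between the
      -- copy and `H`.
      deg-H-≤ : ∀ {v a} → IsCopy a v → deg H a ≤ deg Labelled v
      deg-H-≤ {v} {a} ℓv≡ = deg-mono H Labelled IsCopy
        (λ ℓy≡ ℓy≡′ → ,-injectiveʳ (inj₂-injective (trans (sym ℓy≡) ℓy≡′)))
        (λ {b} a~b → let u , ℓu≡ = copy i b in
          u , subst₂ C._~_ (sym ℓv≡) (sym ℓu≡) (refl , a~b) , ℓu≡)

      deg-≤-H : ∀ {v a} → IsCopy a v → deg Labelled v ≤ deg H a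
      deg-≤-H ℓv≡ = deg-mono Labelled H (λ v a → IsCopy a v)
        (λ ℓx≡ ℓx′≡ → ℓ-injective (trans ℓx≡ (sym ℓx′≡)))
        (λ v~x → let b , ℓx≡ , a~b = copy-neighbour ℓv≡ v~x in b , a~b , ℓx≡)

      module _ (D : Subset k) (sd : StrongDominating Labelled D) where

        private
          trace? : Decidable λ a → proj₁ (copy i a) ∈ D
          trace? a = proj₁ (copy i a) ∈? D

        trace : Subset m
        trace = tabulate (does ∘ trace?)

        -- The dominator of a vertex of the copy lies in the same copy, where degrees agree with
        -- those in `H`.
        trace-strongDominating : StrongDominating H trace
        trace-strongDominating a a∉ =
          let v , ℓv≡ = copy i a
              u , u∈D , v~u , deg-≤ = sd v (a∉ ∘ ∈-tabulate⁺ trace?)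
              b , ℓu≡ , a~b = copy-neighbour ℓv≡ v~u
          in  b ,
              ∈-tabulate⁺ trace?
                (subst (_∈ D) (ℓ-injective (trans ℓu≡ (sym (proj₂ (copy i b))))) u∈D) ,
              a~b ,
              ≤-trans (deg-H-≤ ℓv≡) (≤-trans deg-≤ (deg-≤-H ℓu≡))

        -- The argument from `Fin m` picks a vertex of the `j`-th copy, which survives even for
        -- `j ≡ i`. It is in `D` or has its dominator in its own block.
        meets-block : Fin m → ∀ j → ∃ λ v → v ∈ D × block (ℓ v) ≡ j
        meets-block a j with copy j a
        ... | v , ℓv≡ with v ∈? D
        ...   | yes v∈D = v , v∈D , cong (block {n} {m}) ℓv≡
        ...   | no  v∉D =
          let u , u∈D , v~u , _ = sd v v∉D
          in  u , u∈D , copy-~⇒block (ℓ u) (subst (C._~ ℓ u) ℓv≡ v~u)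

        -- One representative per block, together with a second element of `D` in block `i`, injects
        -- `Fin (suc n)` into `D`.
        n<∣D∣ : 2 ≤ γst H → n < ∣ D ∣
        n<∣D∣ 2≤γst = begin
          suc n         ≡⟨ ∣⊤∣≡n (suc n) ⟨
          ∣ ⊤ {suc n} ∣ ≤⟨ ∣∣-mono (λ x y → y ≡ vertex x)
                             (λ y≡ y≡′ → vertex-injective (trans (sym y≡) y≡′)) ⊤ D
                             (λ {x} _ → vertex x , vertex-∈ x , refl) ⟩
          ∣ D ∣         ∎
          where
          open ≤-Reasoning

          2≤∣trace∣ : 2 ≤ ∣ trace ∣
          2≤∣trace∣ = ≤-trans 2≤γst (γst-least H trace trace-strongDominating)

          inBlock? : Decidable λ v → v ∈ D × block (ℓ v) ≡ i
          inBlock? v = (v ∈? D) ×-dec (block (ℓ v) Fin.≟ i)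

          inBlock : Subset k
          inBlock = tabulate (does ∘ inBlock?)

          ∣trace∣≤∣inBlock∣ : ∣ trace ∣ ≤ ∣ inBlock ∣
          ∣trace∣≤∣inBlock∣ = ∣∣-mono IsCopy
            (λ ℓy≡ ℓy≡′ → ,-injectiveʳ (inj₂-injective (trans (sym ℓy≡) ℓy≡′)))
            trace inBlock
            (λ {a} a∈ → let v , ℓv≡ = copy i a in
              v , ∈-tabulate⁺ inBlock? (∈-tabulate⁻ trace? a∈ , cong (block {n} {m}) ℓv≡) , ℓv≡)

          rep : ∀ j → ∃ λ v → v ∈ D × block (ℓ v) ≡ j
          -- The vertex of `H` required here is the first element of `trace`, which is nonempty.
          rep = meets-block (embed trace (fromℕ< (≤-trans (s≤s z≤n) 2≤∣trace∣)))

          second : ∃ λ v → v ∈ inBlock × v ≢ proj₁ (rep i)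
          -- The block holds at least two elements of `D`, so one of them differs from the
          -- representative already chosen.
          second = ∃-other inBlock (≤-trans 2≤∣trace∣ ∣trace∣≤∣inBlock∣) (proj₁ (rep i))

          second∈ : proj₁ second ∈ D × block (ℓ (proj₁ second)) ≡ i
          second∈ = ∈-tabulate⁻ inBlock? (proj₁ (proj₂ second))

          vertex : Fin (suc n) → Fin k
          vertex zero    = proj₁ second
          vertex (suc j) = proj₁ (rep j)

          vertex-∈ : ∀ x → vertex x ∈ D
          vertex-∈ zero    = proj₁ second∈
          vertex-∈ (suc j) = proj₁ (proj₂ (rep j))

          second≢rep : ∀ j → proj₁ second ≢ proj₁ (rep j)
          second≢rep j eq = proj₂ (proj₂ second) (trans eq (cong (proj₁ ∘ rep) j≡i))
            where
            j≡i : j ≡ i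
            j≡i = trans (sym (proj₂ (proj₂ (rep j))))
                    (trans (cong (block ∘ ℓ) (sym eq)) (proj₂ second∈))

          vertex-injective : Injective _≡_ _≡_ vertex
          vertex-injective {zero}  {zero}   _  = refl
          vertex-injective {zero}  {suc j}  eq = contradiction eq (second≢rep j)
          vertex-injective {suc j} {zero}   eq = contradiction (sym eq) (second≢rep j)
          vertex-injective {suc j} {suc j′} eq = cong suc
            (trans (sym (proj₂ (proj₂ (rep j))))
              (trans (cong (block ∘ ℓ) eq) (proj₂ (proj₂ (rep j′)))))

  -- Each copy vertex is dominated by its root, whose degree is large enough by
  -- `deg-copy-≤-deg-root`.
  γst-⊚-≤ : γst (G ⊚ H) ≤ n
  γst-⊚-≤ = begin
    γst (G ⊚ H) ≤⟨ γst-least (G ⊚ H) roots dominating ⟩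
    ∣ roots ∣   ≤⟨ ∣∣-mono (λ v i → decode v ≡ inj₁ i)
                     (λ v≡ v′≡ → decode-injective {n} {m} (trans v≡ (sym v′≡))) roots ⊤
                     (λ {v} v∈ → let i , v≡ = ∈-tabulate⁻ isRoot? v∈ in i , ∈⊤ , v≡) ⟩
    ∣ ⊤ {n} ∣   ≡⟨ ∣⊤∣≡n n ⟩
    n           ∎
    where
    open ≤-Reasoning

    isRoot? : Decidable λ v → ∃ λ i → decode {n} {m} v ≡ inj₁ i
    isRoot? v with decode {n} {m} v
    ... | inj₁ i = yes (i , refl)
    ... | inj₂ _ = no λ ()

    roots : Subset (n + n * m)
    roots = tabulate (does ∘ isRoot?)

    dominating : StrongDominating (G ⊚ H) roots
    dominating v v∉ = dominate (decode v) refl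
      where
      dominate : ∀ x → decode v ≡ x → ∃ λ u → u ∈ roots ×
                 decode v C.~ decode u × deg (G ⊚ H) v ≤ deg (G ⊚ H) u
      dominate (inj₁ i) v≡ = contradiction (∈-tabulate⁺ isRoot? (i , v≡)) v∉
      dominate (inj₂ (i , a)) v≡ =
        encode (inj₁ i) ,
        ∈-tabulate⁺ isRoot? (i , root≡) ,
        subst₂ C._~_ (sym v≡) (sym root≡) refl ,
        deg-copy-≤-deg-root decode (decode-injective {n} {m}) v≡ root≡
        where
        root≡ : decode (encode (inj₁ i)) ≡ inj₁ i
        root≡ = decode-encode (inj₁ i)

  n<γst-⊚-root : ∀ i → 2 ≤ γst H → n < γst ((G ⊚ H) - ⁅ encode (inj₁ i) ⁆)
  n<γst-⊚-root i 2≤γst with γst-attained ((G ⊚ H) - ⁅ encode (inj₁ i) ⁆)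
  ... | D , sd , ∣D∣≡γst =
    subst (n <_) ∣D∣≡γst (n<∣D∣ ℓ ℓ-injective root-deleted others-kept D sd 2≤γst)
    where
    kept : Subset (n + n * m)
    kept = ∁ ⁅ encode (inj₁ i) ⁆

    -- For this labelling `Labelled` unfolds to the corona without the root, so `n<∣D∣` applies to
    -- `D` directly.
    ℓ : Fin ∣ kept ∣ → CoronaVertex G H
    ℓ = decode ∘ embed kept

    ℓ-injective : Injective _≡_ _≡_ ℓ
    ℓ-injective = embed-injective kept ∘ decode-injective {n} {m}

    root-deleted : ∀ v → ℓ v ≢ inj₁ i
    root-deleted v ℓv≡ = x∈∁p⇒x∉p (embed-∈ kept v)
      (subst (_∈ ⁅ encode (inj₁ i) ⁆)
        (trans (cong encode (sym ℓv≡)) (encode-decode {n} {m} (embed kept v)))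
        (x∈⁅x⁆ (encode (inj₁ i))))

    others-kept : ∀ x → x ≢ inj₁ i → ∃ λ v → ℓ v ≡ x
    others-kept x x≢ =
      let v , v≡ = embed-surjective kept (x∉p⇒x∈∁p λ x∈ → x≢ (encode-injective (x∈⁅y⁆⇒x≡y _ x∈)))
      in  v , trans (cong decode v≡) (decode-encode x)
      where
      encode-injective : encode x ≡ encode (inj₁ i) → x ≡ inj₁ i
      encode-injective eq =
        trans (sym (decode-encode x)) (trans (cong decode eq) (decode-encode (inj₁ i)))

proposition4p4 : ∀ {n m : ℕ} (G : Graph n) (H : Graph m) → 1 ≤ n → 2 ≤ γst H → IsStability (G ⊚ H) 1
proposition4p4 {suc n} {m} G H _ 2≤γst =
  -- Any root would do; `zero` exists because `G` is nonempty. Deleting it pushes `γst` above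
  -- `suc n`, which bounds it for the full corona.
  (⁅ root ⁆ , ∣⁅x⁆∣≡1 root , λ eq →
    <⇒≱ (n<γst-⊚-root G H zero 2≤γst) (≤-trans (≤-reflexive eq) (γst-⊚-≤ G H))) ,
  λ where
    zero    (S , ∣S∣≡0 , γst≢) →
      contradiction (≅⇒γst-≡ (∣S∣≡0⇒G-S≅G (G ⊚ H) S ∣S∣≡0)) γst≢
    (suc _) _ → s≤s z≤n
  where
  root : Fin (suc n + suc n * m)
  root = encode {suc n} (inj₁ zero)
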